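{- For each $\epsilon>0$ and integer $d\ge1$ there exists a constant $C''(d,\epsilon)=2^{O_\epsilon(d^3)}$ such that for all integers $d\le k\le n$ and every $d$-uniform hypergraph $H\subseteq\binom{[n]}{d}$ there exists a $d$-uniform hypergraph $H'\subseteq H$ such that: - $\Pr_{S\sim\nu_n(k)}[S\text{ hits }H']\ge\Pr_{S\sim\nu_n(k)}[S\text{ hits }H]/C''(d,\epsilon)$. - For every $I\in H'$, $$\Pr_{S\sim\nu_n(k)}\bigl[\text{there is no } I'\in H'\setminus\{I\}\text{ with } S\supseteq I'\ \big|\ S\supseteq I\bigr]\ge1-\epsilon.$$
   Context: $[n]=\{1,\dots,n\}$; $\nu_n(k)$ is the uniform distribution on $k$-element subsets of $[n]$. A $d$-uniform hypergraph on $[n]$ is identified with its set of hyperedges, a subset of $\binom{[n]}{d}$. A set $S$ hits $H$ if $S\supseteq I$ for some $I\in H$. The notation $2^{O_\epsilon(d^3)}$ means an upper bound $2^{A d^3}$ with $A$ depending only on $\epsilon$. -}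

module Defs where

open import Data.Bool.Properties using () renaming (_≟_ to _≟ᵇ_)
open import Data.Fin.Subset using (Subset; inside; outside; _⊆_; ∣_∣; ⊤; ⊥)
open import Data.Fin.Subset.Properties
  using (_⊆?_; anySubset?; s⊆s; ⊆⊤; ∣⊤∣≡n; ∣⊥∣≡0)
open import Data.Integer using (+_)
open import Data.List using (List; [_]; _++_; map; filter; length)
open import Data.List.Membership.Propositional using (_∈_)
open import Data.List.Membership.Propositional.Properties
  using (∈-++⁺ˡ; ∈-++⁺ʳ; ∈-map⁺; ∈-filter⁺; ∈-length)
open import Data.List.Relation.Unary.Any using (here)
open import Data.Nat using (ℕ; zero; suc; _≤_; z≤n; s≤s; _≟_; _≤?_; NonZero; >-nonZero)
open import Data.Nat.Properties using (≤-reflexive; ≤-antisym; ≤-trans; ≰⇒>)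
open import Data.Product using (∃; _×_; _,_)
open import Data.Rational using (ℚ; _/_; _÷_)
import Data.Rational as ℚ
open import Data.Rational.Properties using (normalize-pos; pos⇒nonZero)
open import Data.Vec using ([]; _∷_)
open import Data.Vec.Properties using (≡-dec)
open import Level using (0ℓ)
open import Relation.Binary.PropositionalEquality using (_≡_; _≢_; refl; trans; cong)
open import Relation.Nullary using (yes; no)
open import Relation.Nullary.Decidable using (_×-dec_; ¬?)
open import Relation.Unary using (Pred; Decidable; _∩_)
open import Relation.Unary.Properties using (_∩?_)

-- The ground set [n] is Fin n.  Every subset of a finite set is decidable
-- classically, so bundling edge? only fixes which classical object is meant.
record Hypergraph (n d : ℕ) : Set₁ where
  field
    Edge    : Pred (Subset n) 0ℓ
    edge?   : Decidable Edge
    uniform : ∀ {I} → Edge I → ∣ I ∣ ≡ d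

open Hypergraph public

infix 4 _⊆ᴴ_
_⊆ᴴ_ : ∀ {n d} → Hypergraph n d → Hypergraph n d → Set
H′ ⊆ᴴ H = ∀ {I} → Edge H′ I → Edge H I

infixl 6 _∖_
_∖_ : ∀ {n d} → Hypergraph n d → Subset n → Hypergraph n d
(H ∖ I) .Edge I′         = Edge H I′ × I′ ≢ I
(H ∖ I) .edge? I′        = edge? H I′ ×-dec ¬? (≡-dec _≟ᵇ_ I′ I)
(H ∖ I) .uniform (e , _) = uniform H e

Hits : ∀ {n d} → Hypergraph n d → Pred (Subset n) 0ℓ
Hits H S = ∃ λ I → Edge H I × I ⊆ S

hits? : ∀ {n d} (H : Hypergraph n d) → Decidable (Hits H)
hits? H S = anySubset? (λ I → edge? H I ×-dec (I ⊆? S))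

subsets : ∀ n → List (Subset n)
subsets zero    = [ [] ]
subsets (suc n) = map (inside ∷_) (subsets n) ++ map (outside ∷_) (subsets n)

-- Each k-element subset occurs exactly once, so the uniform distribution on
-- list positions below is the uniform distribution on k-element subsets.
kSubsets : ∀ n → ℕ → List (Subset n)
kSubsets n k = filter (λ S → ∣ S ∣ ≟ k) (subsets n)

∈-subsets : ∀ {n} (S : Subset n) → S ∈ subsets n
∈-subsets []            = here refl
∈-subsets (inside  ∷ S) = ∈-++⁺ˡ (∈-map⁺ (inside ∷_) (∈-subsets S))
∈-subsets (outside ∷ S) =
  ∈-++⁺ʳ (map (inside ∷_) (subsets _)) (∈-map⁺ (outside ∷_) (∈-subsets S))

∈-kSubsets : ∀ {n k} (S : Subset n) → ∣ S ∣ ≡ k → S ∈ kSubsets n k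
∈-kSubsets S ∣S∣≡k = ∈-filter⁺ (λ T → ∣ T ∣ ≟ _) (∈-subsets S) ∣S∣≡k

extend : ∀ {n k} (I : Subset n) → ∣ I ∣ ≤ k → k ≤ n → ∃ λ S → I ⊆ S × ∣ S ∣ ≡ k
extend [] _ z≤n = [] , (λ ()) , refl
extend (inside ∷ I) (s≤s ∣I∣≤k) (s≤s k≤n) =
  let S , I⊆S , ∣S∣≡k = extend I ∣I∣≤k k≤n
  in  inside ∷ S , s⊆s I⊆S , cong suc ∣S∣≡k
extend {suc n} {k} (outside ∷ I) ∣I∣≤k k≤1+n with k ≤? n
... | yes k≤n = let S , I⊆S , ∣S∣≡k = extend I ∣I∣≤k k≤n
                in  outside ∷ S , s⊆s I⊆S , ∣S∣≡k
... | no  k≰n = ⊤ , ⊆⊤ , trans (∣⊤∣≡n (suc n)) (≤-antisym (≰⇒> k≰n) k≤1+n)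

kSubsets-nonEmpty : ∀ {n k} → k ≤ n → NonZero (length (kSubsets n k))
kSubsets-nonEmpty {n} k≤n =
  let S , _ , ∣S∣≡k = extend ⊥ (≤-trans (≤-reflexive (∣⊥∣≡0 n)) z≤n) k≤n
  in  >-nonZero (∈-length (∈-kSubsets S ∣S∣≡k))

-- Pr k≤n P? is the probability of P under the uniform distribution ν_n(k).
Pr : ∀ {k n ℓ} {P : Pred (Subset n) ℓ} → .(k ≤ n) → Decidable P → ℚ
Pr {k} {n} k≤n P? =
  _/_ (+ length (filter P? (kSubsets n k))) (length (kSubsets n k))
      {{kSubsets-nonEmpty k≤n}}

-- CondPr k≤n P? Q? is the probability of P given Q.
CondPr : ∀ {k n ℓ₁ ℓ₂} {P : Pred (Subset n) ℓ₁} {Q : Pred (Subset n) ℓ₂} →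
         .(k≤n : k ≤ n) → Decidable P → (Q? : Decidable Q) →
         .{{ℚ.NonZero (Pr k≤n Q?)}} → ℚ
CondPr k≤n P? Q? = Pr k≤n (P? ∩? Q?) ÷ Pr k≤n Q?

Pr-⊇-nonZero : ∀ {k n} {I : Subset n} → ∣ I ∣ ≤ k → (k≤n : k ≤ n) →
               ℚ.NonZero (Pr k≤n (I ⊆?_))
Pr-⊇-nonZero {k} {n} {I} ∣I∣≤k k≤n =
  let S , I⊆S , ∣S∣≡k = extend I ∣I∣≤k k≤n
  in  pos⇒nonZero (Pr k≤n (I ⊆?_)) {{normalize-pos
        (length (filter (I ⊆?_) (kSubsets n k))) (length (kSubsets n k))
        {{kSubsets-nonEmpty k≤n}}
        {{>-nonZero (∈-length (∈-filter⁺ (I ⊆?_) (∈-kSubsets S ∣S∣≡k) I⊆S))}}}}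

edge-Pr-nonZero : ∀ {d k n} (H : Hypergraph n d) {I : Subset n} → Edge H I →
                  d ≤ k → (k≤n : k ≤ n) → ℚ.NonZero (Pr k≤n (I ⊆?_))
edge-Pr-nonZero H I∈H d≤k =
  Pr-⊇-nonZero (≤-trans (≤-reflexive (uniform H I∈H)) d≤k)

{-# OPTIONS --safe #-}
-- Let N s be the number of k-sets containing a given s-set, and D = 2^(e+d) where
-- 2^-e ≤ ε.  If N d > N (d-1) / D, then log-concavity of N gives N d ≥ N 0 / D^d,
-- and a single edge of H suffices.  Otherwise choose greedily a maximal R ⊆ H in
-- which every A with |A| < d has degree at most N |A| / (D N d).  Given S ⊇ I, the
-- expected number of other edges I′ of R in S is, grouping by A = I ∩ I′ and using
-- N |I ∪ I′| N |I ∩ I′| ≤ (N d)², at most 2^d / D = 2^-e, so every edge is isolated,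
-- and the number of k-sets hitting R is at least |R| N d / 2.  By maximality an edge
-- of H outside R contains a set A whose degree is at least half the allowed maximum;
-- as the degrees of R sum to at most 2^d |R|, these sets A are contained in at most
-- 2^(d+1) D |R| N d of the k-sets.
module Submission where

open import Defs
open import Data.Fin.Subset using (Subset)
open import Data.Fin.Subset.Properties using (_⊆?_)
open import Data.Nat as ℕ using (ℕ)
open import Data.Product using (Σ-syntax; ∃-syntax; _×_)
open import Relation.Unary.Properties using (∁?)

open import Data.Bool.Properties using () renaming (_≟_ to _≟ᵇ_)
open import Data.Empty using (⊥-elim)
open import Data.List using (length)
open import Data.Nat using (zero; suc; z≤n; s≤s; NonZero)
open import Data.Product using (∃; _,_; proj₁; proj₂; map₂)
open import Data.Sum as Sum using (_⊎_; inj₁; inj₂; [_,_]′)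
open import Function using (_∘_)
open import Relation.Binary.PropositionalEquality
  using (_≡_; _≢_; refl; sym; trans; cong; cong₂; subst; subst₂; module ≡-Reasoning)
open import Relation.Unary using (Pred; Decidable)
open import Relation.Unary.Properties using (_∩?_)

module Counting where

  open import Data.Fin.Subset using (inside; outside; _⊆_; ∣_∣; _∪_) renaming (_∩_ to _⋂_; ⊥ to ∅)
  open import Data.Fin.Subset.Properties
    using (drop-∷-⊆; out⊆; in⊆in; ∣p∣≤n; ∣p∩q∣≤∣p∣; p∩q⊆p; p∩q⊆q; x∈p∪q⁻; p⊆q⇒∣p∣≤∣q∣; ⊆-trans; ⊥⊆; ∣⊥∣≡0; anySubset?)
  open import Data.List using (List; []; [_]; _∷_; _++_; map; filter)
  open import Data.List.Membership.Propositional using (_∈_; find; lose)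
  open import Data.List.Membership.Propositional.Properties using (∈-filter⁺; ∈-filter⁻; ∈-length)
  import Data.List.Membership.DecPropositional as DecMembership
  open import Data.List.Properties using (filter-++; filter-≐; filter-none; length-++)
  open import Data.List.Relation.Unary.All as All using ([]; _∷_)
  open import Data.List.Relation.Unary.All.Properties using (¬Any⇒All¬)
  open import Data.List.Relation.Unary.AllPairs using ([]; _∷_)
  open import Data.List.Relation.Unary.Any as Any using (Any; here; there)
  open import Data.List.Relation.Unary.Unique.Propositional using (Unique)
  open import Data.Nat using (_+_; _*_; _∸_; _^_; _≤_; _<_; _≟_; _≤?_; _<?_; >-nonZero; ≢-nonZero)
  open import Data.Nat.Combinatorics using (_C_; nCk+nC[k+1]≡[n+1]C[k+1])
  open import Data.Nat.ListAction using (sum)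
  open import Data.Nat.Properties hiding (_≟_; _≤?_; _<?_)
  open import Algebra.Properties.CommutativeSemigroup +-commutativeSemigroup using (x∙yz≈y∙xz)
  open import Data.Nat.Tactic.RingSolver using (solve-∀)
  open import Data.Vec using ([]; _∷_; here)
  open import Data.Vec.Properties using (≡-dec)
  open import Relation.Binary.Definitions using (DecidableEquality)
  open import Relation.Nullary using (¬_; Dec; yes; no; contradiction)
  open import Relation.Nullary.Decidable using (_×-dec_)
  open import Relation.Unary using (_∩_; _≐_)

  -- Counting and double counting over finite lists.

  module _ {A : Set} where

    count : ∀ {ℓ} {P : Pred A ℓ} → Decidable P → List A → ℕ
    count P? xs = length (filter P? xs)

    module _ {p q} {P : Pred A p} {Q : Pred A q} (P? : Decidable P) (Q? : Decidable Q) where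

      count-mono : ∀ xs → (∀ {x} → P x → Q x) → count P? xs ≤ count Q? xs
      count-mono []       P⇒Q = z≤n
      count-mono (x ∷ xs) P⇒Q with P? x | Q? x
      ... | yes _  | yes _  = s≤s (count-mono xs P⇒Q)
      ... | yes px | no ¬qx = contradiction (P⇒Q px) ¬qx
      ... | no _   | yes _  = m≤n⇒m≤1+n (count-mono xs P⇒Q)
      ... | no _   | no _   = count-mono xs P⇒Q

      count-≐ : P ≐ Q → ∀ xs → count P? xs ≡ count Q? xs
      count-≐ P≐Q xs = cong length (filter-≐ P? Q? P≐Q xs)

      count-split : ∀ xs → count P? xs ≡ count (P? ∩? Q?) xs + count (P? ∩? ∁? Q?) xs
      count-split []       = refl
      count-split (x ∷ xs) with P? x | Q? x
      ... | yes _ | yes _ = cong suc (count-split xs)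
      ... | yes _ | no _  = trans (cong suc (count-split xs)) (sym (+-suc _ _))
      ... | no _  | yes _ = count-split xs
      ... | no _  | no _  = count-split xs

      count-filter : ∀ xs → count P? (filter Q? xs) ≡ count (Q? ∩? P?) xs
      count-filter []       = refl
      count-filter (x ∷ xs) with Q? x
      ... | no _ = count-filter xs
      ... | yes _ with P? x
      ...   | yes _ = cong suc (count-filter xs)
      ...   | no _  = count-filter xs

    module _ {p} {P : Pred A p} (P? : Decidable P) where

      count-none : (∀ {x} → ¬ P x) → ∀ xs → count P? xs ≡ 0
      count-none ¬P xs = cong length (filter-none P? (All.universal (λ _ → ¬P) xs))

      count-++ : ∀ xs ys → count P? (xs ++ ys) ≡ count P? xs + count P? ys
      count-++ xs ys = trans (cong length (filter-++ P? xs ys)) (length-++ (filter P? xs))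

      count-map : ∀ {B : Set} (f : B → A) xs → count P? (map f xs) ≡ length (filter (P? ∘ f) xs)
      count-map f []       = refl
      count-map f (x ∷ xs) with P? (f x)
      ... | yes _ = cong suc (count-map f xs)
      ... | no _  = count-map f xs

    count-∩-≤ : ∀ {p q} {P : Pred A p} {Q : Pred A q} (P? : Decidable P) (Q? : Decidable Q) xs →
                count P? xs ≤ count Q? xs + count (P? ∩? ∁? Q?) xs
    count-∩-≤ P? Q? xs = begin
      count P? xs                                       ≡⟨ count-split P? Q? xs ⟩
      count (P? ∩? Q?) xs + count (P? ∩? ∁? Q?) xs      ≤⟨ +-monoˡ-≤ _ (count-mono (P? ∩? Q?) Q? xs proj₂) ⟩
      count Q? xs + count (P? ∩? ∁? Q?) xs              ∎
      where open ≤-Reasoning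

    -- The factor `c` stands in for a denominator: a bound `b` / `c` on each summand can be used
    -- without leaving the naturals.
    sum-map-≤ : ∀ (f : A → ℕ) c b ys → (∀ {y} → y ∈ ys → c * f y ≤ b) →
                c * sum (map f ys) ≤ length ys * b
    sum-map-≤ f c b []       h = ≤-reflexive (*-zeroʳ c)
    sum-map-≤ f c b (y ∷ ys) h = begin
      c * (f y + sum (map f ys))     ≡⟨ *-distribˡ-+ c (f y) _ ⟩
      c * f y + c * sum (map f ys)   ≤⟨ +-mono-≤ (h (here refl)) (sum-map-≤ f c b ys (h ∘ there)) ⟩
      b + length ys * b              ∎
      where open ≤-Reasoning

    sum-map-≥ : ∀ (f : A → ℕ) c b ys → (∀ {y} → y ∈ ys → b ≤ c * f y) →
                length ys * b ≤ c * sum (map f ys)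
    sum-map-≥ f c b []       h = z≤n
    sum-map-≥ f c b (y ∷ ys) h = begin
      b + length ys * b              ≤⟨ +-mono-≤ (h (here refl)) (sum-map-≥ f c b ys (h ∘ there)) ⟩
      c * f y + c * sum (map f ys)   ≡⟨ *-distribˡ-+ c (f y) _ ⟨
      c * (f y + sum (map f ys))     ∎
      where open ≤-Reasoning

    sum-map-mono : ∀ (f g : A → ℕ) c ys → (∀ {y} → y ∈ ys → f y ≤ c * g y) →
                   sum (map f ys) ≤ c * sum (map g ys)
    sum-map-mono f g c []       h = z≤n
    sum-map-mono f g c (y ∷ ys) h = begin
      f y + sum (map f ys)           ≤⟨ +-mono-≤ (h (here refl)) (sum-map-mono f g c ys (h ∘ there)) ⟩
      c * g y + c * sum (map g ys)   ≡⟨ *-distribˡ-+ c (g y) _ ⟨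
      c * (g y + sum (map g ys))     ∎
      where open ≤-Reasoning

    module _ {B : Set} where

      -- Both sides count the related pairs. This later exchanges degrees of sets for numbers of
      -- subsets of edges.
      sum-count-swap : ∀ {r} {R : A → B → Set r} (R? : ∀ a b → Dec (R a b)) xs ys →
                       sum (map (λ x → length (filter (R? x) ys)) xs) ≡
                       sum (map (λ y → count (λ x → R? x y) xs) ys)
      sum-count-swap R? [] ys = sym (sum-0 ys)
        where
        sum-0 : ∀ ys → sum (map (λ _ → 0) ys) ≡ 0
        sum-0 []       = refl
        sum-0 (_ ∷ ys) = sum-0 ys
      sum-count-swap R? (x ∷ xs) ys =
        trans (cong (length (filter (R? x) ys) +_) (sum-count-swap R? xs ys)) (step ys)
        where
        g = λ y → count (λ x′ → R? x′ y) xs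
        step : ∀ ys → length (filter (R? x) ys) + sum (map g ys) ≡
                      sum (map (λ y → count (λ x′ → R? x′ y) (x ∷ xs)) ys)
        step []       = refl
        step (y ∷ ys) with R? x y
        ... | yes _ = cong suc (trans (x∙yz≈y∙xz (length (filter (R? x) ys)) (g y) _) (cong (g y +_) (step ys)))
        ... | no _  = trans (x∙yz≈y∙xz (length (filter (R? x) ys)) (g y) _) (cong (g y +_) (step ys))

      module _ {q} {Q : B → Pred A q} (Q? : ∀ y → Decidable (Q y)) where

        -- Elements satisfying `Q y` are charged to the head `y` and removed from `P`, so the tail
        -- covers whatever is left.
        union-bound : ∀ {p} {P : Pred A p} (P? : Decidable P) xs ys →
                      (∀ {x} → P x → ∃ λ y → y ∈ ys × Q y x) →
                      count P? xs ≤ sum (map (λ y → count (Q? y) xs) ys)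
        union-bound P? xs []       cover = ≤-reflexive (count-none P? (λ px → noElem (cover px)) xs)
          where
          noElem : ∀ {x} → ¬ (∃ λ y → y ∈ [] × Q y x)
          noElem (_ , () , _)
        union-bound P? xs (y ∷ ys) cover = ≤-trans (count-∩-≤ P? (Q? y) xs)
          (+-monoʳ-≤ (count (Q? y) xs) (union-bound (P? ∩? ∁? (Q? y)) xs ys cover′))
          where
          cover′ : ∀ {x} → _ → ∃ λ y′ → y′ ∈ ys × Q y′ x
          cover′ (px , ¬qx) with cover px
          ... | _  , here refl , q = contradiction q ¬qx
          ... | y′ , there y′∈ , q = y′ , y′∈ , q

        -- The converse peeling: after the elements of `Q y` are removed from `P`, disjointness and
        -- uniqueness keep every later class inside the remainder.
        disjoint-bound : ∀ {p} {P : Pred A p} (P? : Decidable P) xs {ys} → Unique ys →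
                         (∀ {y x} → y ∈ ys → Q y x → P x) →
                         (∀ {y y′ x} → y ∈ ys → y′ ∈ ys → Q y x → Q y′ x → y ≡ y′) →
                         sum (map (λ y → count (Q? y) xs) ys) ≤ count P? xs
        disjoint-bound P? xs []              Q⇒P disj = z≤n
        disjoint-bound P? xs {y ∷ ys} (y∉ys ∷ uniq) Q⇒P disj = begin
          count (Q? y) xs + sum (map (λ y → count (Q? y) xs) ys)
            ≤⟨ +-mono-≤ (count-mono (Q? y) (P? ∩? Q? y) xs (λ qx → Q⇒P (here refl) qx , qx))
                        (disjoint-bound (P? ∩? ∁? (Q? y)) xs uniq
                          (λ y′∈ q → Q⇒P (there y′∈) q ,
                            λ q₀ → All.lookup y∉ys y′∈ (disj (here refl) (there y′∈) q₀ q))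
                          (λ y∈ y′∈ → disj (there y∈) (there y′∈))) ⟩
          count (P? ∩? Q? y) xs + count (P? ∩? ∁? (Q? y)) xs
            ≡⟨ count-split P? (Q? y) xs ⟨
          count P? xs ∎
          where open ≤-Reasoning

  -- Binomial identities and the number of k-sets containing a given set.

  [k+1]*[n+1]C[k+1]≡[n+1]*nCk : ∀ n k → suc k * (suc n C suc k) ≡ suc n * (n C k)
  [k+1]*[n+1]C[k+1]≡[n+1]*nCk zero    zero    = refl
  [k+1]*[n+1]C[k+1]≡[n+1]*nCk zero    (suc k) = *-zeroʳ (suc (suc k))
  [k+1]*[n+1]C[k+1]≡[n+1]*nCk (suc n) zero    = begin
    1 * (suc (suc n) C 1)      ≡⟨ cong (1 *_) (nCk+nC[k+1]≡[n+1]C[k+1] (suc n) 0) ⟨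
    1 * (1 + suc n C 1)        ≡⟨ *-distribˡ-+ 1 1 (suc n C 1) ⟩
    1 + 1 * (suc n C 1)        ≡⟨ cong suc ([k+1]*[n+1]C[k+1]≡[n+1]*nCk n 0) ⟩
    1 + suc n * 1              ≡⟨⟩
    suc (suc n) * 1            ∎
    where open ≡-Reasoning
  [k+1]*[n+1]C[k+1]≡[n+1]*nCk (suc n) (suc k) = begin
    suc (suc k) * (suc (suc n) C suc (suc k))
      ≡⟨ cong (suc (suc k) *_) (nCk+nC[k+1]≡[n+1]C[k+1] (suc n) (suc k)) ⟨
    suc (suc k) * (b + suc n C suc (suc k))
      ≡⟨ expand (suc k) b (suc n C suc (suc k)) ⟩
    b + suc k * b + suc (suc k) * (suc n C suc (suc k))
      ≡⟨ cong₂ (λ x y → b + x + y) ([k+1]*[n+1]C[k+1]≡[n+1]*nCk n k) ([k+1]*[n+1]C[k+1]≡[n+1]*nCk n (suc k)) ⟩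
    b + suc n * (n C k) + suc n * (n C suc k)
      ≡⟨ trans (+-assoc b _ _) (cong (b +_) (sym (*-distribˡ-+ (suc n) (n C k) (n C suc k)))) ⟩
    b + suc n * (n C k + n C suc k)
      ≡⟨ cong (λ x → b + suc n * x) (nCk+nC[k+1]≡[n+1]C[k+1] n k) ⟩
    suc (suc n) * b ∎
    where
    open ≡-Reasoning
    b = suc n C suc k
    expand : ∀ k b c → suc k * (b + c) ≡ b + k * b + suc k * c
    expand = solve-∀

  -- The number of k-element sets containing a given s-element set with m
  -- elements outside of it; unlike m C (k ∸ s), it vanishes for k < s.
  completions : ℕ → ℕ → ℕ → ℕ
  completions m k       zero    = m C k
  completions m zero    (suc s) = 0
  completions m (suc k) (suc s) = completions m k s

  completions-zero : ∀ m s → completions (suc m) 0 s ≡ completions m 0 s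
  completions-zero m zero    = refl
  completions-zero m (suc s) = refl

  completions-pascal : ∀ m k s → completions m k s + completions m (suc k) s ≡ completions (suc m) (suc k) s
  completions-pascal m k       zero    = nCk+nC[k+1]≡[n+1]C[k+1] m k
  completions-pascal m zero    (suc s) = sym (completions-zero m s)
  completions-pascal m (suc k) (suc s) = completions-pascal m k s

  -- Lowering `k` and `s` together changes neither side, which leaves the absorption identity for
  -- binomials. For `s` at least `k` both sides vanish, so truncated subtraction does no harm.
  completions-absorb : ∀ m k s → completions m k (suc s) * suc m ≡ completions (suc m) k s * (k ∸ s)
  completions-absorb m zero    zero    = refl
  completions-absorb m zero    (suc s) = refl
  completions-absorb m (suc k) zero    = begin
    (m C k) * suc m             ≡⟨ *-comm (m C k) (suc m) ⟩
    suc m * (m C k)             ≡⟨ [k+1]*[n+1]C[k+1]≡[n+1]*nCk m k ⟨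
    suc k * (suc m C suc k)     ≡⟨ *-comm (suc k) (suc m C suc k) ⟩
    (suc m C suc k) * suc k     ∎
    where open ≡-Reasoning
  completions-absorb m (suc k) (suc s) = completions-absorb m k s

  k<s⇒completions≡0 : ∀ m {k s} → k < s → completions m k s ≡ 0
  k<s⇒completions≡0 m {zero}  (s≤s _)   = refl
  k<s⇒completions≡0 m {suc k} (s≤s k<s) = k<s⇒completions≡0 m k<s

  -- The binomial coefficient C(n - s, k - s) when s ≤ k; it is the function called `N` below.
  supersets : ℕ → ℕ → ℕ → ℕ
  supersets n k s = completions (n ∸ s) k s

  -- Split on whether S contains the first point. If A contains it, S must too, and one point is
  -- spent on both sides; otherwise both choices remain and Pascal's rule adds them.
  count-⊇-subsets : ∀ n k (A : Subset n) →
    count (λ S → (∣ S ∣ ≟ k) ×-dec (A ⊆? S)) (subsets n) ≡ supersets n k ∣ A ∣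
  count-⊇-subsets zero    zero    [] = refl
  count-⊇-subsets zero    (suc k) [] = refl
  count-⊇-subsets (suc n) k (x ∷ A) = trans
    (count-++ (Q? x k) (map (inside ∷_) (subsets n)) _)
    (trans (cong₂ _+_ (count-map (Q? x k) (inside ∷_) (subsets n)) (count-map (Q? x k) (outside ∷_) (subsets n))) (go x k))
    where
    Q? : ∀ x k → Decidable _
    Q? x k S = (∣ S ∣ ≟ k) ×-dec ((x ∷ A) ⊆? S)
    R? : ∀ k → Decidable _
    R? k S = (∣ S ∣ ≟ k) ×-dec (A ⊆? S)
    out∷ : ∀ k → count (Q? outside k ∘ (outside ∷_)) (subsets n) ≡ count (R? k) (subsets n)
    out∷ k = count-≐ (Q? outside k ∘ (outside ∷_)) (R? k)
      ((λ (e , s) → e , drop-∷-⊆ s) , (λ (e , s) → e , out⊆ s)) (subsets n)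
    in∷ : ∀ k x → (∀ {S} → A ⊆ S → x ∷ A ⊆ inside ∷ S) →
          count (Q? x (suc k) ∘ (inside ∷_)) (subsets n) ≡ count (R? k) (subsets n)
    in∷ k x f = count-≐ (Q? x (suc k) ∘ (inside ∷_)) (R? k)
      ((λ (e , s) → suc-injective e , drop-∷-⊆ s) , (λ (e , s) → cong suc e , f s)) (subsets n)
    go : ∀ x k → count (Q? x k ∘ (inside ∷_)) (subsets n) + count (Q? x k ∘ (outside ∷_)) (subsets n)
               ≡ supersets (suc n) k ∣ x ∷ A ∣
    go inside k rewrite count-none (Q? inside k ∘ (outside ∷_)) (λ (_ , s) → contradiction (s here) λ ()) (subsets n)
                      | +-identityʳ (count (Q? inside k ∘ (inside ∷_)) (subsets n)) with k
    ... | zero  = count-none (Q? inside 0 ∘ (inside ∷_)) (λ ()) (subsets n)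
    ... | suc k = trans (in∷ k inside in⊆in) (count-⊇-subsets n k A)
    -- Pascal's rule is stated for a successor k. For k = 0 only S avoiding the first point
    -- survives, and the count does not change with the number of points outside A.
    go outside zero = begin
      count (Q? outside 0 ∘ (inside ∷_)) (subsets n) + count (Q? outside 0 ∘ (outside ∷_)) (subsets n)
        ≡⟨ cong₂ _+_ (count-none (Q? outside 0 ∘ (inside ∷_)) (λ ()) (subsets n)) (out∷ 0) ⟩
      count (R? 0) (subsets n)         ≡⟨ count-⊇-subsets n 0 A ⟩
      supersets n 0 ∣ A ∣              ≡⟨ completions-zero (n ∸ ∣ A ∣) ∣ A ∣ ⟨
      completions (suc (n ∸ ∣ A ∣)) 0 ∣ A ∣  ≡⟨ cong (λ m → completions m 0 ∣ A ∣) (+-∸-assoc 1 (∣p∣≤n A)) ⟨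
      supersets (suc n) 0 ∣ A ∣        ∎
      where open ≡-Reasoning
    go outside (suc k) = begin
      count (Q? outside (suc k) ∘ (inside ∷_)) (subsets n) + count (Q? outside (suc k) ∘ (outside ∷_)) (subsets n)
        ≡⟨ cong₂ _+_ (in∷ k outside out⊆) (out∷ (suc k)) ⟩
      count (R? k) (subsets n) + count (R? (suc k)) (subsets n)
        ≡⟨ cong₂ _+_ (count-⊇-subsets n k A) (count-⊇-subsets n (suc k) A) ⟩
      supersets n k ∣ A ∣ + supersets n (suc k) ∣ A ∣
        ≡⟨ completions-pascal (n ∸ ∣ A ∣) k ∣ A ∣ ⟩
      completions (suc (n ∸ ∣ A ∣)) (suc k) ∣ A ∣
        ≡⟨ cong (λ m → completions m (suc k) ∣ A ∣) (+-∸-assoc 1 (∣p∣≤n A)) ⟨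
      supersets (suc n) (suc k) ∣ A ∣ ∎
      where open ≡-Reasoning

  count-⊇ : ∀ {n} k (A : Subset n) → count (A ⊆?_) (kSubsets n k) ≡ supersets n k ∣ A ∣
  count-⊇ {n} k A = trans (count-filter (A ⊆?_) (λ S → ∣ S ∣ ≟ k) (subsets n)) (count-⊇-subsets n k A)

  count-⊆ : ∀ {n} (I : Subset n) → count (_⊆? I) (subsets n) ≡ 2 ^ ∣ I ∣
  count-⊆ []       = refl
  count-⊆ {suc n} (x ∷ I) = trans
    (count-++ (_⊆? (x ∷ I)) (map (inside ∷_) (subsets n)) _)
    (trans (cong₂ _+_ (count-map (_⊆? (x ∷ I)) (inside ∷_) (subsets n)) (count-map (_⊆? (x ∷ I)) (outside ∷_) (subsets n))) (go x))
    where
    IH : ∀ x → count ((_⊆? (x ∷ I)) ∘ (outside ∷_)) (subsets n) ≡ 2 ^ ∣ I ∣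
    IH x = trans (count-≐ _ (_⊆? I) (drop-∷-⊆ , λ s → out⊆ s) (subsets n)) (count-⊆ I)
    go : ∀ x → count ((_⊆? (x ∷ I)) ∘ (inside ∷_)) (subsets n) + count ((_⊆? (x ∷ I)) ∘ (outside ∷_)) (subsets n) ≡ 2 ^ ∣ x ∷ I ∣
    go inside  = cong₂ _+_ (trans (count-≐ _ (_⊆? I) (drop-∷-⊆ , λ s → in⊆in s) (subsets n)) (count-⊆ I))
                           (trans (IH inside) (sym (+-identityʳ _)))
    go outside = cong₂ _+_ (count-none _ (λ s → contradiction (s here) λ ()) (subsets n)) (IH outside)

  -- Monotonicity and log-concavity of the superset counts.

  ∣p∪q∣+∣p∩q∣≡∣p∣+∣q∣ : ∀ {n} (p q : Subset n) → ∣ p ∪ q ∣ + ∣ p ⋂ q ∣ ≡ ∣ p ∣ + ∣ q ∣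
  ∣p∪q∣+∣p∩q∣≡∣p∣+∣q∣ []            []            = refl
  ∣p∪q∣+∣p∩q∣≡∣p∣+∣q∣ (inside  ∷ p) (inside  ∷ q) =
    cong suc (trans (+-suc _ _) (trans (cong suc (∣p∪q∣+∣p∩q∣≡∣p∣+∣q∣ p q)) (sym (+-suc _ _))))
  ∣p∪q∣+∣p∩q∣≡∣p∣+∣q∣ (inside  ∷ p) (outside ∷ q) = cong suc (∣p∪q∣+∣p∩q∣≡∣p∣+∣q∣ p q)
  ∣p∪q∣+∣p∩q∣≡∣p∣+∣q∣ (outside ∷ p) (inside  ∷ q) =
    trans (cong suc (∣p∪q∣+∣p∩q∣≡∣p∣+∣q∣ p q)) (sym (+-suc _ _))
  ∣p∪q∣+∣p∩q∣≡∣p∣+∣q∣ (outside ∷ p) (outside ∷ q) = ∣p∪q∣+∣p∩q∣≡∣p∣+∣q∣ p q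

  module _ {n k : ℕ} (k≤n : k ≤ n) where

    private N = supersets n k

    supersets-absorb : ∀ {s} → s < n → N (suc s) * (n ∸ s) ≡ N s * (k ∸ s)
    supersets-absorb {s} s<n rewrite +-∸-assoc 1 s<n = completions-absorb (n ∸ suc s) k s

    supersets-anti-suc : ∀ s → N (suc s) ≤ N s
    supersets-anti-suc s with k ≤? s
    ... | yes k≤s rewrite k<s⇒completions≡0 (n ∸ suc s) (s≤s k≤s) = z≤n
    ... | no  k≰s = *-cancelʳ-≤ (N (suc s)) (N s) (n ∸ s) {{>-nonZero (m<n⇒0<n∸m s<n)}} (begin
      N (suc s) * (n ∸ s)   ≡⟨ supersets-absorb s<n ⟩
      N s * (k ∸ s)         ≤⟨ *-monoʳ-≤ (N s) (∸-monoˡ-≤ s k≤n) ⟩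
      N s * (n ∸ s)         ∎)
      where
      open ≤-Reasoning
      s<n = <-≤-trans (≰⇒> k≰s) k≤n

    supersets-anti : ∀ s j → N (s + j) ≤ N s
    supersets-anti s zero    rewrite +-identityʳ s = ≤-refl
    supersets-anti s (suc j) rewrite +-suc s j = ≤-trans (supersets-anti-suc (s + j)) (supersets-anti s j)

    -- By `supersets-absorb` the ratio N (s + 1) / N s is (k - s) / (n - s), which does not increase
    -- with s. Denominators are cleared, and the case t ≥ k is trivial because N (t + 1) is 0.
    supersets-logConcave-suc : ∀ {s t} → s ≤ t → N s * N (suc t) ≤ N (suc s) * N t
    supersets-logConcave-suc {s} {t} s≤t with k ≤? t
    ... | yes k≤t rewrite k<s⇒completions≡0 (n ∸ suc t) (s≤s k≤t) | *-zeroʳ (N s) = z≤n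
    ... | no  k≰t = *-cancelʳ-≤ _ _ ((n ∸ s) * (n ∸ t))
          {{m*n≢0 (n ∸ s) (n ∸ t) {{>-nonZero (m<n⇒0<n∸m s<n)}} {{>-nonZero (m<n⇒0<n∸m t<n)}}}} (begin
      N s * N (suc t) * ((n ∸ s) * (n ∸ t))     ≡⟨ regroup (N s) (N (suc t)) (n ∸ s) (n ∸ t) ⟩
      N s * (n ∸ s) * (N (suc t) * (n ∸ t))     ≡⟨ cong (N s * (n ∸ s) *_) (supersets-absorb t<n) ⟩
      N s * (n ∸ s) * (N t * (k ∸ t))           ≡⟨ regroup (N s) (n ∸ s) (N t) (k ∸ t) ⟩
      N s * N t * ((n ∸ s) * (k ∸ t))           ≤⟨ *-monoʳ-≤ (N s * N t) cross ⟩
      N s * N t * ((k ∸ s) * (n ∸ t))           ≡⟨ regroup (N s) (N t) (k ∸ s) (n ∸ t) ⟩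
      N s * (k ∸ s) * (N t * (n ∸ t))           ≡⟨ cong (_* (N t * (n ∸ t))) (supersets-absorb s<n) ⟨
      N (suc s) * (n ∸ s) * (N t * (n ∸ t))     ≡⟨ regroup (N (suc s)) (N t) (n ∸ s) (n ∸ t) ⟨
      N (suc s) * N t * ((n ∸ s) * (n ∸ t))     ∎)
      where
      open ≤-Reasoning
      t<k = ≰⇒> k≰t
      t<n = <-≤-trans t<k k≤n
      s<n = ≤-<-trans s≤t t<n
      regroup : ∀ a b c d → a * b * (c * d) ≡ a * c * (b * d)
      regroup = solve-∀
      -- Writing n - u as (k - u) + (n - k) for u = s and u = t leaves only k - t ≤ k - s to
      -- compare.
      cross : (n ∸ s) * (k ∸ t) ≤ (k ∸ s) * (n ∸ t)
      cross = begin
        (n ∸ s) * (k ∸ t)                             ≡⟨ cong (_* (k ∸ t)) n∸s ⟩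
        ((k ∸ s) + (n ∸ k)) * (k ∸ t)                 ≡⟨ *-distribʳ-+ (k ∸ t) (k ∸ s) (n ∸ k) ⟩
        (k ∸ s) * (k ∸ t) + (n ∸ k) * (k ∸ t)         ≤⟨ +-monoʳ-≤ ((k ∸ s) * (k ∸ t)) (*-monoʳ-≤ (n ∸ k) (∸-monoʳ-≤ k s≤t)) ⟩
        (k ∸ s) * (k ∸ t) + (n ∸ k) * (k ∸ s)         ≡⟨ factor (k ∸ s) (k ∸ t) (n ∸ k) ⟩
        (k ∸ s) * ((k ∸ t) + (n ∸ k))                 ≡⟨ cong ((k ∸ s) *_) n∸t ⟨
        (k ∸ s) * (n ∸ t)                             ∎
        where
        split : ∀ {u} → u ≤ k → n ∸ u ≡ (k ∸ u) + (n ∸ k)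
        split {u} u≤k = trans (cong (_∸ u) (sym (m+[n∸m]≡n k≤n))) (+-∸-comm (n ∸ k) u≤k)
        n∸t = split (<⇒≤ t<k)
        n∸s = split (≤-trans s≤t (<⇒≤ t<k))
        factor : ∀ a b c → a * b + c * a ≡ a * (b + c)
        factor = solve-∀

    -- Each step moves one unit from the larger argument to the smaller. Once s reaches t, both
    -- sides agree up to order.
    supersets-logConcave : ∀ j {s t} → s ≤ t → N s * N (t + j) ≤ N (s + j) * N t
    supersets-logConcave zero    {s} {t} _ rewrite +-identityʳ s | +-identityʳ t = ≤-refl
    supersets-logConcave (suc j) {s} {t} s≤t with m≤n⇒m<n∨m≡n s≤t
    ... | inj₂ refl = ≤-reflexive (*-comm (N s) _)
    ... | inj₁ s<t rewrite +-suc t j | +-suc s j =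
      ≤-trans (supersets-logConcave-suc (≤-trans s≤t (m≤m+n t j))) (supersets-logConcave j s<t)

    -- With a the size of the intersection, the union has size d + (d - a). Log-concavity then
    -- applies to a ≤ d with shift d - a.
    supersets-∪-∩ : ∀ {d} (p q : Subset n) → ∣ p ∣ ≡ d → ∣ q ∣ ≡ d →
                    N ∣ p ⋂ q ∣ * N ∣ p ∪ q ∣ ≤ N d * N d
    supersets-∪-∩ {d} p q refl ∣q∣≡d = begin
      N a * N ∣ p ∪ q ∣    ≡⟨ cong (λ s → N a * N s) (+-cancelʳ-≡ a ∣ p ∪ q ∣ (d + j) union) ⟩
      N a * N (d + j)      ≤⟨ supersets-logConcave j a≤d ⟩
      N (a + j) * N d      ≡⟨ cong (λ s → N s * N d) (m+[n∸m]≡n a≤d) ⟩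
      N d * N d            ∎
      where
      open ≤-Reasoning
      a = ∣ p ⋂ q ∣
      a≤d = ∣p∩q∣≤∣p∣ p q
      j = d ∸ a
      union : ∣ p ∪ q ∣ + a ≡ d + j + a
      union = trans (∣p∪q∣+∣p∩q∣≡∣p∣+∣q∣ p q) (trans (cong (d +_) ∣q∣≡d)
        (trans (cong (d +_) (sym (m∸n+n≡m a≤d))) (sym (+-assoc d j a))))

  -- Degrees and the greedy selection of edges.

  infix 4 _≟ˢ_
  _≟ˢ_ : ∀ {n} → DecidableEquality (Subset n)
  _≟ˢ_ = ≡-dec _≟ᵇ_

  degree : ∀ {n} → List (Subset n) → Subset n → ℕ
  degree R A = count (A ⊆?_) R

  degree-mono : ∀ {n} I (R : List (Subset n)) A → degree R A ≤ degree (I ∷ R) A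
  degree-mono I R A with A ⊆? I
  ... | yes _ = n≤1+n _
  ... | no _  = ≤-refl

  -- Writing N s for the number of k-sets containing a given s-set, a random k-set
  -- that contains A is expected to contain degree R A * N d / N ∣ A ∣ edges of R;
  -- branching bounds this by 1/D for all proper subsets A of edges.
  module _ (N : ℕ → ℕ) (D d : ℕ) {n : ℕ} where

    Branching : List (Subset n) → Set
    Branching R = ∀ A → ∣ A ∣ < d → D * (degree R A * N d) ≤ N ∣ A ∣

    -- Half the degree that `Branching` permits already suffices; the factor 2 absorbs the single
    -- edge by which a rejected insertion would overshoot.
    Saturated : List (Subset n) → Subset n → Set
    Saturated R A = ∣ A ∣ < d × N ∣ A ∣ ≤ 2 * (D * (degree R A * N d))

    saturated? : ∀ R → Decidable (Saturated R)
    saturated? R A = (∣ A ∣ <? d) ×-dec (N ∣ A ∣ ≤? 2 * (D * (degree R A * N d)))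

    -- `cover` is maximality in a form stable under later insertions: degrees only grow, so a
    -- saturated set stays saturated.
    record Pruning (L : List (Subset n)) : Set where
      field
        edges     : List (Subset n)
        edges⊆    : ∀ {I} → I ∈ edges → I ∈ L
        unique    : Unique edges
        branching : Branching edges
        cover     : ∀ {I} → I ∈ L → I ∈ edges ⊎ ∃ λ A → A ⊆ I × Saturated edges A

    saturated-mono : ∀ I R {A} → Saturated R A → Saturated (I ∷ R) A
    saturated-mono I R {A} (A<d , sat) =
      A<d , ≤-trans sat (*-monoʳ-≤ 2 (*-monoʳ-≤ D (*-monoˡ-≤ (N d) (degree-mono I R A))))

    module _ (sparse : ∀ {a} → a < d → D * N d ≤ N a) where

      -- If A is not inside `I`, inserting `I` leaves its degree alone and `Branching` forbids the
      -- violation. Otherwise the degree rises from m to m + 1: `sparse` excludes m = 0, and m + 1 ≤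
      -- 2m for all other m.
      blocked⇒saturated : ∀ {I R A} → Branching R → ∣ A ∣ < d → N ∣ A ∣ < D * (degree (I ∷ R) A * N d) →
                          A ⊆ I × Saturated R A
      blocked⇒saturated {I} {R} {A} branching A<d blocked with A ⊆? I
      ... | no A⊈I = contradiction blocked (≤⇒≯ (branching A A<d))
      ... | yes A⊆I = A⊆I , A<d , helper (degree R A) blocked
        where
        double : ∀ D m x → D * (suc (suc m) * x) + D * (m * x) ≡ 2 * (D * (suc m * x))
        double = solve-∀
        helper : ∀ m → N ∣ A ∣ < D * (suc m * N d) → N ∣ A ∣ ≤ 2 * (D * (m * N d))
        helper zero    lt = contradiction
          (<-≤-trans lt (≤-reflexive (cong (D *_) (+-identityʳ (N d))))) (≤⇒≯ (sparse A<d))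
        helper (suc m) lt = begin
          N ∣ A ∣                                          ≤⟨ <⇒≤ lt ⟩
          D * (suc (suc m) * N d)                          ≤⟨ m≤m+n _ _ ⟩
          D * (suc (suc m) * N d) + D * (m * N d)          ≡⟨ double D m (N d) ⟩
          2 * (D * (suc m * N d))                          ∎
          where open ≤-Reasoning

      insert : ∀ I {L} → Pruning L → Pruning (I ∷ L)
      insert I p = choose (I ∈? R) (anySubset? λ A → (∣ A ∣ <? d) ×-dec (N ∣ A ∣ <? D * (degree (I ∷ R) A * N d)))
        where
        open DecMembership _≟ˢ_ using (_∈?_)
        open Pruning p renaming (edges to R)
        Blocking : Subset n → Set
        Blocking A = ∣ A ∣ < d × N ∣ A ∣ < D * (degree (I ∷ R) A * N d)
        choose : Dec (I ∈ R) → Dec (∃ Blocking) → Pruning (I ∷ _)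
        -- A repeated entry of the list is skipped, which keeps the kept edges distinct.
        choose (yes I∈R) _ = record
          { edges = R ; edges⊆ = there ∘ edges⊆ ; unique = unique ; branching = branching
          ; cover = λ { (here refl) → inj₁ I∈R ; (there J∈L) → cover J∈L } }
        choose (no _) (yes (A , A<d , blocked)) = record
          { edges = R ; edges⊆ = there ∘ edges⊆ ; unique = unique ; branching = branching
          ; cover = λ { (here refl) → inj₂ (A , blocked⇒saturated branching A<d blocked)
                      ; (there J∈L) → cover J∈L } }
        choose (no I∉R) (no ¬blocked) = record
          { edges     = I ∷ R
          ; edges⊆    = λ { (here refl) → here refl ; (there J∈R) → there (edges⊆ J∈R) }
          ; unique    = ¬Any⇒All¬ R I∉R ∷ unique
          ; branching = λ A A<d → ≮⇒≥ λ blocked → ¬blocked (A , A<d , blocked)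
          ; cover     = λ { (here refl) → inj₁ (here refl)
                          ; (there J∈L) → Sum.map there (map₂ (map₂ (saturated-mono I R))) (cover J∈L) } }

      prune : ∀ L → Pruning L
      prune []      = record
        { edges = [] ; edges⊆ = λ () ; unique = []
        ; branching = λ _ _ → ≤-trans (≤-reflexive (*-zeroʳ D)) z≤n ; cover = λ () }
      prune (I ∷ L) = insert I (prune L)

  -- Collisions between kept edges, and bounds on the sets that are hit.

  fromList : ∀ {n d} (R : List (Subset n)) → (∀ {I} → I ∈ R → ∣ I ∣ ≡ d) → Hypergraph n d
  fromList R uniform .Edge I    = I ∈ R
  fromList R uniform .edge? I   = DecMembership._∈?_ _≟ˢ_ I R
  fromList R uniform .uniform   = uniform

  count-⊇-nonZero : ∀ {n k} (I : Subset n) → ∣ I ∣ ≤ k → k ≤ n → NonZero (count (I ⊆?_) (kSubsets n k))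
  count-⊇-nonZero I I≤k k≤n =
    let S , I⊆S , ∣S∣≡k = extend I I≤k k≤n
    in  >-nonZero (∈-length (∈-filter⁺ (I ⊆?_) (∈-kSubsets S ∣S∣≡k) I⊆S))

  p⊆q∧∣q∣≤∣p∣⇒p≡q : ∀ {n} {p q : Subset n} → p ⊆ q → ∣ q ∣ ≤ ∣ p ∣ → p ≡ q
  p⊆q∧∣q∣≤∣p∣⇒p≡q {p = []}          {[]}          _   _        = refl
  p⊆q∧∣q∣≤∣p∣⇒p≡q {p = inside  ∷ p} {inside  ∷ q} p⊆q (s≤s le) =
    cong (inside ∷_) (p⊆q∧∣q∣≤∣p∣⇒p≡q (drop-∷-⊆ p⊆q) le)
  p⊆q∧∣q∣≤∣p∣⇒p≡q {p = inside  ∷ p} {outside ∷ q} p⊆q _        = contradiction (p⊆q here) λ ()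
  p⊆q∧∣q∣≤∣p∣⇒p≡q {p = outside ∷ p} {inside  ∷ q} p⊆q le       =
    contradiction le (≤⇒≯ (p⊆q⇒∣p∣≤∣q∣ (drop-∷-⊆ p⊆q)))
  p⊆q∧∣q∣≤∣p∣⇒p≡q {p = outside ∷ p} {outside ∷ q} p⊆q le       =
    cong (outside ∷_) (p⊆q∧∣q∣≤∣p∣⇒p≡q (drop-∷-⊆ p⊆q) le)

  ∣p∩q∣<∣p∣ : ∀ {n} (p q : Subset n) → ∣ p ∣ ≡ ∣ q ∣ → p ≢ q → ∣ p ⋂ q ∣ < ∣ p ∣
  ∣p∩q∣<∣p∣ p q ∣p∣≡∣q∣ p≢q = ≰⇒> λ ∣p∣≤∣p∩q∣ → p≢q (trans
    (sym (p⊆q∧∣q∣≤∣p∣⇒p≡q (p∩q⊆p p q) ∣p∣≤∣p∩q∣))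
    (p⊆q∧∣q∣≤∣p∣⇒p≡q (p∩q⊆q p q) (subst (_≤ ∣ p ⋂ q ∣) ∣p∣≡∣q∣ ∣p∣≤∣p∩q∣)))

  module _ {n k d : ℕ} (R : List (Subset n)) (uniformR : ∀ {I} → I ∈ R → ∣ I ∣ ≡ d) where

    private
      N = supersets n k
      K = kSubsets n k
      HR = fromList R uniformR

    module _ {D : ℕ} (k≤n : k ≤ n) (d≤k : d ≤ k) (branching : Branching N D d R) where

      module _ {I : Subset n} (I∈R : I ∈ R) where

        private
          -- Collisions are grouped by the exact intersection with `I`, since its size fixes the
          -- size of the union of the two edges.
          Meets : Subset n → Pred (Subset n) _
          Meets A = (I ⊆_) ∩ (λ S → Any (λ I′ → I ⋂ I′ ≡ A × I′ ⊆ S) R)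
          meets? : ∀ A → Decidable (Meets A)
          meets? A = (I ⊆?_) ∩? (λ S → Any.any? (λ I′ → (I ⋂ I′ ≟ˢ A) ×-dec (I′ ⊆? S)) R)

        -- At most `degree R A` edges meet `I` in exactly A, and by `supersets-∪-∩` each accounts
        -- for at most (N d)² / N a of the k-sets. `branching` turns the product into N d / D.
        count-meets-≤ : ∀ {A} → A ⊆ I → ∣ A ∣ < d → D * count (meets? A) K ≤ N d
        -- The cancelled N a is nonzero because A extends to some k-set.
        count-meets-≤ {A} A⊆I A<d = *-cancelˡ-≤ (N a) {{subst NonZero (count-⊇ k A) (count-⊇-nonZero A (≤-trans (<⇒≤ A<d) d≤k) k≤n)}} (begin
          N a * (D * c)                         ≡⟨ swap (N a) D c ⟩
          D * (N a * c)                         ≤⟨ *-monoʳ-≤ D (*-monoʳ-≤ (N a) union) ⟩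
          D * (N a * sum (map (λ I′ → count ((I ∪ I′) ⊆?_) K) Zs))
                                                ≤⟨ *-monoʳ-≤ D (sum-map-≤ _ (N a) (N d * N d) Zs each) ⟩
          D * (length Zs * (N d * N d))         ≤⟨ *-monoʳ-≤ D (*-monoˡ-≤ (N d * N d) Zs≤degree) ⟩
          D * (degree R A * (N d * N d))        ≡⟨ regroup D (degree R A) (N d) ⟩
          D * (degree R A * N d) * N d          ≤⟨ *-monoˡ-≤ (N d) (branching A A<d) ⟩
          N a * N d                             ∎)
          where
          open ≤-Reasoning
          a = ∣ A ∣
          c = count (meets? A) K
          Zs = filter (λ I′ → I ⋂ I′ ≟ˢ A) R
          swap : ∀ x y z → x * (y * z) ≡ y * (x * z)
          swap = solve-∀
          regroup : ∀ x y z → x * (y * (z * z)) ≡ x * (y * z) * z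
          regroup = solve-∀
          union : c ≤ sum (map (λ I′ → count ((I ∪ I′) ⊆?_) K) Zs)
          union = union-bound (λ I′ → (I ∪ I′) ⊆?_) (meets? A) K Zs λ (I⊆S , any) →
            let I′ , I′∈R , eq , I′⊆S = find any
            in  I′ , ∈-filter⁺ _ I′∈R eq , λ x∈ → [ I⊆S , I′⊆S ]′ (x∈p∪q⁻ I I′ x∈)
          each : ∀ {I′} → I′ ∈ Zs → N a * count ((I ∪ I′) ⊆?_) K ≤ N d * N d
          each {I′} I′∈Zs with ∈-filter⁻ (λ I′ → I ⋂ I′ ≟ˢ A) {xs = R} I′∈Zs
          ... | I′∈R , refl rewrite count-⊇ k (I ∪ I′) = supersets-∪-∩ k≤n I I′ (uniformR I∈R) (uniformR I′∈R)
          Zs≤degree : length Zs ≤ degree R A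
          Zs≤degree = count-mono (λ I′ → I ⋂ I′ ≟ˢ A) (A ⊆?_) R λ {I′} eq → subst (_⊆ I′) eq (p∩q⊆q I I′)

        -- Distinct edges of equal size meet in a proper subset of `I`. There are at most 2 ^ d of
        -- these, and each costs at most N d / D.
        count-collision-≤ : D * count ((I ⊆?_) ∩? hits? (HR ∖ I)) K ≤ 2 ^ d * N d
        count-collision-≤ = begin
          D * count ((I ⊆?_) ∩? hits? (HR ∖ I)) K
            ≤⟨ *-monoʳ-≤ D (union-bound meets? _ K As cover) ⟩
          D * sum (map (λ A → count (meets? A) K) As)
            ≤⟨ sum-map-≤ _ D (N d) As each ⟩
          length As * N d
            ≤⟨ *-monoˡ-≤ (N d) As≤ ⟩
          2 ^ d * N d ∎
          where
          open ≤-Reasoning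
          proper? : Decidable _
          proper? A = (A ⊆? I) ×-dec (∣ A ∣ <? d)
          As = filter proper? (subsets n)
          cover : ∀ {S} → (I ⊆ S) × Hits (HR ∖ I) S → ∃ λ A → A ∈ As × Meets A S
          cover (I⊆S , I′ , (I′∈R , I′≢I) , I′⊆S) = I ⋂ I′
            , ∈-filter⁺ proper? (∈-subsets (I ⋂ I′))
                (p∩q⊆p I I′ , subst (∣ I ⋂ I′ ∣ <_) (uniformR I∈R)
                  (∣p∩q∣<∣p∣ I I′ (trans (uniformR I∈R) (sym (uniformR I′∈R))) (I′≢I ∘ sym)))
            , I⊆S , lose I′∈R (refl , I′⊆S)
          each : ∀ {A} → A ∈ As → D * count (meets? A) K ≤ N d
          each A∈As = let _ , A⊆I , A<d = ∈-filter⁻ proper? {xs = subsets n} A∈As in count-meets-≤ A⊆I A<d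
          As≤ : length As ≤ 2 ^ d
          As≤ = begin
            length As                        ≤⟨ count-mono proper? (_⊆? I) (subsets n) proj₁ ⟩
            count (_⊆? I) (subsets n)        ≡⟨ count-⊆ I ⟩
            2 ^ ∣ I ∣                        ≡⟨ cong (2 ^_) (uniformR I∈R) ⟩
            2 ^ d                            ∎

    -- At least half of the k-sets above an edge contain no other edge of R. These families are
    -- disjoint for distinct edges, so their sizes add up inside the hitting sets.
    edges≤2*hits : Unique R →
                   (∀ {I} → I ∈ R → 2 * count ((I ⊆?_) ∩? hits? (HR ∖ I)) K ≤ count (I ⊆?_) K) →
                   length R * N d ≤ 2 * count (hits? HR) K
    edges≤2*hits unique isolated = begin
      length R * N d                                        ≤⟨ sum-map-≥ _ 2 (N d) R each ⟩
      2 * sum (map (λ I → count (alone? I) K) R)            ≤⟨ *-monoʳ-≤ 2 (disjoint-bound alone? (hits? HR) K unique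
                                                                  (λ I∈R (I⊆S , _) → _ , I∈R , I⊆S) same) ⟩
      2 * count (hits? HR) K                                ∎
      where
      open ≤-Reasoning
      alone? : ∀ I → Decidable ((I ⊆_) ∩ (λ S → ¬ Hits (HR ∖ I) S))
      alone? I = (I ⊆?_) ∩? ∁? (hits? (HR ∖ I))
      same : ∀ {I I′ S} → I ∈ R → I′ ∈ R → (I ⊆ S) × (¬ Hits (HR ∖ I) S) → (I′ ⊆ S) × (¬ Hits (HR ∖ I′) S) → I ≡ I′
      same {I} {I′} I∈R I′∈R (I⊆S , ¬hit) (I′⊆S , _) with I′ ≟ˢ I
      ... | yes eq = sym eq
      ... | no neq = ⊥-elim (¬hit (I′ , (I′∈R , neq) , I′⊆S))
      each : ∀ {I} → I ∈ R → N d ≤ 2 * count (alone? I) K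
      each {I} I∈R = begin
        N d                ≡⟨ cong N (uniformR I∈R) ⟨
        N ∣ I ∣            ≡⟨ count-⊇ k I ⟨
        count (I ⊆?_) K    ≡⟨ splitI ⟩
        b + g              ≤⟨ +-monoˡ-≤ g b≤g ⟩
        g + g              ≡⟨ cong (g +_) (+-identityʳ g) ⟨
        2 * g              ∎
        where
        b = count ((I ⊆?_) ∩? hits? (HR ∖ I)) K
        g = count (alone? I) K
        splitI = count-split (I ⊆?_) (hits? (HR ∖ I)) K
        b≤g : b ≤ g
        b≤g = +-cancelˡ-≤ b b g (begin
          b + b             ≡⟨ cong (b +_) (+-identityʳ b) ⟨
          2 * b             ≤⟨ isolated I∈R ⟩
          count (I ⊆?_) K   ≡⟨ splitI ⟩
          b + g             ∎)

    module _ {D : ℕ} where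

      -- Saturation bounds the k-sets above A by a multiple of the degree of A. Summed over all
      -- saturated A, the degrees count pairs of a saturated set and an edge above it, at most 2 ^ d
      -- for each edge.
      count-hits-saturated : ∀ {p} {P : Pred (Subset n) p} (P? : Decidable P) →
                      (∀ {S} → P S → ∃ λ A → A ⊆ S × Saturated N D d R A) →
                      count P? K ≤ 2 * (D * N d) * (length R * 2 ^ d)
      count-hits-saturated P? cover = begin
        count P? K
          ≤⟨ union-bound (λ A → A ⊆?_) P? K As (λ p → let A , A⊆S , sat = cover p in A , ∈-filter⁺ sat? (∈-subsets A) sat , A⊆S) ⟩
        sum (map (λ A → count (A ⊆?_) K) As)
          ≤⟨ sum-map-mono _ (degree R) (2 * (D * N d)) As each ⟩
        2 * (D * N d) * sum (map (degree R) As)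
          ≡⟨ cong (2 * (D * N d) *_) (sum-count-swap _⊆?_ As R) ⟩
        2 * (D * N d) * sum (map (λ I → count (_⊆? I) As) R)
          ≡⟨ cong (2 * (D * N d) *_) (*-identityˡ _) ⟨
        2 * (D * N d) * (1 * sum (map (λ I → count (_⊆? I) As) R))
          ≤⟨ *-monoʳ-≤ (2 * (D * N d)) (sum-map-≤ _ 1 (2 ^ d) R each′) ⟩
        2 * (D * N d) * (length R * 2 ^ d) ∎
        where
        open ≤-Reasoning
        sat? = saturated? N D d R
        As = filter sat? (subsets n)
        regroup : ∀ D m x → 2 * (D * (m * x)) ≡ 2 * (D * x) * m
        regroup = solve-∀
        each : ∀ {A} → A ∈ As → count (A ⊆?_) K ≤ 2 * (D * N d) * degree R A
        each {A} A∈As = begin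
          count (A ⊆?_) K                  ≡⟨ count-⊇ k A ⟩
          N ∣ A ∣                          ≤⟨ proj₂ (proj₂ (∈-filter⁻ sat? {xs = subsets n} A∈As)) ⟩
          2 * (D * (degree R A * N d))     ≡⟨ regroup D (degree R A) (N d) ⟩
          2 * (D * N d) * degree R A       ∎
        each′ : ∀ {I} → I ∈ R → 1 * count (_⊆? I) As ≤ 2 ^ d
        each′ {I} I∈R = begin
          1 * count (_⊆? I) As                ≡⟨ *-identityˡ _ ⟩
          count (_⊆? I) As                    ≡⟨ count-filter (_⊆? I) sat? (subsets n) ⟩
          count (sat? ∩? (_⊆? I)) (subsets n) ≤⟨ count-mono _ (_⊆? I) (subsets n) proj₂ ⟩
          count (_⊆? I) (subsets n)           ≡⟨ count-⊆ I ⟩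
          2 ^ ∣ I ∣                           ≡⟨ cong (2 ^_) (uniformR I∈R) ⟩
          2 ^ d                               ∎

  -- The constants, and the sparse and dense cases.

  exponent-bounds : ∀ e d .{{_ : NonZero d}} →
    3 + (e + d) + d ≤ (e + 5) * d ^ 3 × (e + d) * d ≤ (e + 5) * d ^ 3
  exponent-bounds e d@(suc _) = lhs , rhs
    where
    open ≤-Reasoning
    c = d ^ 3
    1≤c : 1 ≤ c
    1≤c = m^n>0 d 3
    d≤c : d ≤ c
    d≤c = m≤m*n d (d ^ 2) {{m^n≢0 d 2}}
    d*d≤c : d * d ≤ c
    d*d≤c = *-monoʳ-≤ d (m≤m*n d (d ^ 1) {{m^n≢0 d 1}})
    e≤ec : e ≤ e * c
    e≤ec = m≤m*n e c {{>-nonZero 1≤c}}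
    -- In units of d ^ 3 the terms 3, e + d and d cost at most 3, e + 1 and 1, whence the
    -- coefficient e + 5.
    lhs = begin
      3 + (e + d) + d              ≤⟨ +-mono-≤ (+-mono-≤ (*-monoʳ-≤ 3 1≤c) (+-mono-≤ e≤ec d≤c)) d≤c ⟩
      3 * c + (e * c + c) + c      ≡⟨ collect e c ⟩
      (e + 5) * c                  ∎
      where
      collect : ∀ e c → 3 * c + (e * c + c) + c ≡ (e + 5) * c
      collect = solve-∀
    rhs = begin
      (e + d) * d          ≡⟨ *-distribʳ-+ d e d ⟩
      e * d + d * d        ≤⟨ +-mono-≤ (*-monoʳ-≤ e d≤c) d*d≤c ⟩
      e * c + c            ≤⟨ +-monoʳ-≤ (e * c) (m≤n*m c 5) ⟩
      e * c + 5 * c        ≡⟨ *-distribʳ-+ c e 5 ⟨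
      (e + 5) * c          ∎

  -- The conclusion of the theorem in whole-number counts: `T` is the loss in hitting probability,
  -- and 2 ^ e is the inverse of the tolerated conditional probability of a collision.
  record Isolated (e : ℕ) {n d} (k : ℕ) (H : Hypergraph n d) (T : ℕ) : Set₁ where
    field
      sub      : Hypergraph n d
      sub⊆     : sub ⊆ᴴ H
      hits-≤   : count (hits? H) (kSubsets n k) ≤ T * count (hits? sub) (kSubsets n k)
      isolated : ∀ {I} → Edge sub I →
                 2 ^ e * count ((I ⊆?_) ∩? hits? (sub ∖ I)) (kSubsets n k) ≤ count (I ⊆?_) (kSubsets n k)

  isolated-weaken : ∀ {e n d k T U} {H : Hypergraph n d} → T ≤ U → Isolated e k H T → Isolated e k H U
  isolated-weaken T≤U iso = record
    { sub = sub ; sub⊆ = sub⊆ ; isolated = isolated ; hits-≤ = ≤-trans hits-≤ (*-monoˡ-≤ _ T≤U) }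
    where open Isolated iso

  module _ {e k n d′ : ℕ} (1≤e : 1 ≤ e) (d≤k : suc d′ ≤ k) (k≤n : k ≤ n) (H : Hypergraph n (suc d′)) where

    private
      d = suc d′
      D = 2 ^ (e + d)
      N = supersets n k
      K = kSubsets n k

    isolated-sparse : D * N d ≤ N d′ → Isolated e k H (2 ^ (3 + (e + d) + d))
    isolated-sparse DN≤N = record
      { sub      = HR
      ; sub⊆     = proj₂ ∘ inH
      ; hits-≤   = hits-bound
      ; isolated = isolation
      }
      where
      open ≤-Reasoning
      -- The hypothesis concerns size d - 1 alone; since N is antitone, it passes to all smaller
      -- sizes.
      sparse : ∀ {a} → a < d → D * N d ≤ N a
      sparse {a} (s≤s a≤d′) = ≤-trans DN≤N
        (subst (λ s → N s ≤ N a) (m+[n∸m]≡n a≤d′) (supersets-anti k≤n a (d′ ∸ a)))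
      L = filter (edge? H) (subsets n)
      open Pruning (prune N D d sparse L) renaming (edges to R)
      inH : ∀ {I} → I ∈ R → I ∈ subsets n × Edge H I
      inH I∈R = ∈-filter⁻ (edge? H) {xs = subsets n} (edges⊆ I∈R)
      uniformR : ∀ {I} → I ∈ R → ∣ I ∣ ≡ d
      uniformR I∈R = uniform H (proj₂ (inH I∈R))
      HR = fromList R uniformR
      isolation : ∀ {I} → I ∈ R → 2 ^ e * count ((I ⊆?_) ∩? hits? (HR ∖ I)) K ≤ count (I ⊆?_) K
      -- D was chosen as 2 ^ e times 2 ^ d so that the 2 ^ d possible intersections cancel here.
      isolation {I} I∈R = *-cancelˡ-≤ (2 ^ d) {{m^n≢0 2 d}} (begin
        2 ^ d * (2 ^ e * c)     ≡⟨ *-assoc (2 ^ d) (2 ^ e) c ⟨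
        2 ^ d * 2 ^ e * c       ≡⟨ cong (_* c) (trans (*-comm (2 ^ d) (2 ^ e)) (sym (^-distribˡ-+-* 2 e d))) ⟩
        D * c                   ≤⟨ count-collision-≤ R uniformR {D} k≤n d≤k branching I∈R ⟩
        2 ^ d * N d             ≡⟨ cong (2 ^ d *_) (trans (count-⊇ k I) (cong N (uniformR I∈R))) ⟨
        2 ^ d * count (I ⊆?_) K ∎)
        where c = count ((I ⊆?_) ∩? hits? (HR ∖ I)) K
      h = count (hits? HR) K
      edges-bound : length R * N d ≤ 2 * h
      -- As e ≥ 1, a collision probability of at most 2 ^ -e is at most one half.
      edges-bound = edges≤2*hits R uniformR unique
        λ {I} I∈R → ≤-trans (*-monoˡ-≤ (count ((I ⊆?_) ∩? hits? (HR ∖ I)) K) (^-monoʳ-≤ 2 1≤e)) (isolation I∈R)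
      missed : ∀ {S} → Hits H S × (¬ Hits HR S) → ∃ λ A → A ⊆ S × Saturated N D d R A
      missed {S} ((I , I∈H , I⊆S) , ¬hit) with cover (∈-filter⁺ (edge? H) (∈-subsets I) I∈H)
      ... | inj₁ I∈R = ⊥-elim (¬hit (I , I∈R , I⊆S))
      ... | inj₂ (A , A⊆I , sat) = A , ⊆-trans A⊆I I⊆S , sat
      hits-bound : count (hits? H) K ≤ 2 ^ (3 + (e + d) + d) * h
      hits-bound = begin
        count (hits? H) K                                   ≤⟨ count-∩-≤ (hits? H) (hits? HR) K ⟩
        h + count (hits? H ∩? ∁? (hits? HR)) K              ≤⟨ +-monoʳ-≤ h (count-hits-saturated R uniformR {D}
                                                                (hits? H ∩? ∁? (hits? HR)) missed) ⟩
        h + 2 * (D * N d) * (length R * 2 ^ d)              ≡⟨ cong (h +_) (regroup D (N d) (length R) (2 ^ d)) ⟩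
        h + 2 * (D * 2 ^ d) * (length R * N d)              ≤⟨ +-monoʳ-≤ h (*-monoʳ-≤ (2 * (D * 2 ^ d)) edges-bound) ⟩
        h + 2 * (D * 2 ^ d) * (2 * h)                       ≡⟨ collect (D * 2 ^ d) h ⟩
        -- Rounding 1 + 4X up to 8X makes the constant a pure power of 2 and accounts for the 3 in
        -- the exponent.
        (1 + 4 * (D * 2 ^ d)) * h                           ≤⟨ *-monoˡ-≤ h (+-monoˡ-≤ (4 * X) 1≤4X) ⟩
        (4 * X + 4 * X) * h                                 ≡⟨ cong (_* h) (eight X) ⟩
        2 ^ 3 * (D * 2 ^ d) * h                             ≡⟨ cong (λ x → 2 ^ 3 * x * h) (^-distribˡ-+-* 2 (e + d) d) ⟨
        2 ^ 3 * 2 ^ ((e + d) + d) * h                       ≡⟨ cong (_* h) (^-distribˡ-+-* 2 3 (e + d + d)) ⟨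
        2 ^ (3 + (e + d) + d) * h                           ∎
        where
        X = D * 2 ^ d
        1≤4X : 1 ≤ 4 * X
        1≤4X = ≤-trans (*-mono-≤ (m^n>0 2 (e + d)) (m^n>0 2 d)) (m≤n*m X 4)
        eight : ∀ x → 4 * x + 4 * x ≡ 2 ^ 3 * x
        eight = solve-∀
        regroup : ∀ a b c x → 2 * (a * b) * (c * x) ≡ 2 * (a * x) * (c * b)
        regroup = solve-∀
        collect : ∀ x h → h + 2 * x * (2 * h) ≡ (1 + 4 * x) * h
        collect = solve-∀

    -- By log-concavity N s / N (s + 1) is largest at s = d - 1, where it is below D, so N 0 ≤ D ^ d
    -- * N d. One edge thus already hits a 1 / D ^ d fraction of all k-sets, and it has no other
    -- edge to collide with.
    isolated-dense : N d′ < D * N d → Isolated e k H (D ^ d)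
    isolated-dense N<DN with anySubset? (edge? H)
    ... | no noEdge = record
      { sub      = H
      ; sub⊆     = λ I∈H → I∈H
      ; hits-≤   = ≤-trans (≤-reflexive (count-none (hits? H) (λ (I , I∈H , _) → noEdge (I , I∈H)) K)) z≤n
      ; isolated = λ I∈H → ⊥-elim (noEdge (_ , I∈H))
      }
    ... | yes (I , I∈H) = record
      { sub      = HI
      ; sub⊆     = λ { (here refl) → I∈H }
      ; hits-≤   = hits-bound
      ; isolated = λ { {J} (here refl) → ≤-trans (≤-reflexive (trans
          (cong (2 ^ e *_) (count-none ((J ⊆?_) ∩? hits? (HI ∖ J)) (λ { (_ , _ , (here refl , J≢J) , _) → J≢J refl }) K))
          (*-zeroʳ (2 ^ e)))) z≤n }
      }
      where
      open ≤-Reasoning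
      HI = fromList [ I ] λ { (here refl) → uniform H I∈H }
      instance
        -- The strict inequality `N<DN` rules out N d = 0, which permits the cancellation in
        -- `ratio`.
        N≢0 : NonZero (N d)
        N≢0 = ≢-nonZero λ Nd≡0 → n≮0 (<-≤-trans N<DN (≤-reflexive (trans (cong (D *_) Nd≡0) (*-zeroʳ D))))
      regroup : ∀ a b c → a * (b * c) ≡ b * a * c
      regroup = solve-∀
      ratio : ∀ {s} → s < d → N s ≤ D * N (suc s)
      ratio {s} (s≤s s≤d′) = *-cancelʳ-≤ (N s) (D * N (suc s)) (N d) (begin
        N s * N d                ≤⟨ supersets-logConcave-suc k≤n s≤d′ ⟩
        N (suc s) * N d′         ≤⟨ *-monoʳ-≤ (N (suc s)) (<⇒≤ N<DN) ⟩
        N (suc s) * (D * N d)    ≡⟨ regroup (N (suc s)) D (N d) ⟩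
        D * N (suc s) * N d      ∎)
      N0≤ : ∀ {s} → s ≤ d → N 0 ≤ D ^ s * N s
      N0≤ {zero}  _   = ≤-reflexive (sym (+-identityʳ (N 0)))
      N0≤ {suc s} s<d = begin
        N 0                          ≤⟨ N0≤ (<⇒≤ s<d) ⟩
        D ^ s * N s                  ≤⟨ *-monoʳ-≤ (D ^ s) (ratio s<d) ⟩
        D ^ s * (D * N (suc s))      ≡⟨ regroup (D ^ s) D (N (suc s)) ⟩
        D ^ suc s * N (suc s)        ∎
      hits-bound : count (hits? H) K ≤ D ^ d * count (hits? HI) K
      hits-bound = begin
        -- All k-sets are counted, as the supersets of the empty set, in order to reach N 0.
        count (hits? H) K              ≤⟨ count-mono (hits? H) (∅ ⊆?_) K (λ _ → ⊥⊆) ⟩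
        count (∅ ⊆?_) K                ≡⟨ trans (count-⊇ k (∅ {n})) (cong N (∣⊥∣≡0 n)) ⟩
        N 0                            ≤⟨ N0≤ ≤-refl ⟩
        D ^ d * N d                    ≡⟨ cong (D ^ d *_) (trans (count-⊇ k I) (cong N (uniform H I∈H))) ⟨
        D ^ d * count (I ⊆?_) K        ≤⟨ *-monoʳ-≤ (D ^ d) (count-mono (I ⊆?_) (hits? HI) K (λ I⊆S → I , here refl , I⊆S)) ⟩
        D ^ d * count (hits? HI) K     ∎

  isolate : ∀ {e d k n} → 1 ≤ e → 1 ≤ d → d ≤ k → k ≤ n → (H : Hypergraph n d) →
            Isolated e k H (2 ^ ((e + 5) * d ^ 3))
  isolate {e} {d@(suc d′)} {k} {n} 1≤e _ d≤k k≤n H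
    with 2 ^ (e + d) * supersets n k d ≤? supersets n k d′ | exponent-bounds e d
  ... | yes sparse | bound , _ = isolated-weaken (^-monoʳ-≤ 2 bound) (isolated-sparse 1≤e d≤k k≤n H sparse)
  ... | no  dense  | _ , bound = isolated-weaken
    (≤-trans (≤-reflexive (^-*-assoc 2 (e + d) d)) (^-monoʳ-≤ 2 bound)) (isolated-dense 1≤e d≤k k≤n H (≰⇒> dense))

-- From counts to rational probabilities.

module Fractions where

  open import Data.Integer as ℤ using (+_; +[1+_])
  import Data.Integer.Properties as ℤ
  import Data.Nat.Properties as ℕ
  open import Data.Rational as ℚ
    using (ℚ; mkℚ; 0ℚ; 1ℚ; _<_; _≤_; _-_; _+_; _*_; -_; _÷_; _/_; 1/_; Positive; *<*; toℚᵘ)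
  open import Data.Rational.Properties
  open import Data.Rational.Solver using (module +-*-Solver)
  open import Data.Rational.Unnormalised as ℚᵘ using (mkℚᵘ; *≡*; *≤*)
  import Data.Rational.Unnormalised.Properties as ℚᵘ
  open import Data.Product using (swap)
  open Counting using (count; count-split; count-≐; count-⊇-nonZero; Isolated; module Isolated)

  -- Passing to unnormalised fractions keeps numerators and denominators explicit, free of the gcd
  -- reduction performed by `_/_`.
  toℚᵘ-/ : ∀ i n .{{_ : ℕ.NonZero n}} → toℚᵘ (i / n) ℚᵘ.≃ (i ℚᵘ./ n)
  toℚᵘ-/ i (suc n) = toℚᵘ-fromℚᵘ (mkℚᵘ i n)

  /-monoˡ-≤ : ∀ {a b} n .{{_ : ℕ.NonZero n}} → a ℕ.≤ b → (+ a) / n ≤ (+ b) / n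
  /-monoˡ-≤ {a} {b} n@(suc n-1) a≤b = toℚᵘ-cancel-≤ (begin
    toℚᵘ ((+ a) / n)   ≃⟨ toℚᵘ-/ (+ a) n ⟩
    mkℚᵘ (+ a) n-1     ≤⟨ *≤* (ℤ.*-monoʳ-≤-nonNeg (+ n) (ℤ.+≤+ a≤b)) ⟩
    mkℚᵘ (+ b) n-1     ≃⟨ toℚᵘ-/ (+ b) n ⟨
    toℚᵘ ((+ b) / n)   ∎)
    where open ℚᵘ.≤-Reasoning

  /-distribʳ-+ : ∀ a b n .{{_ : ℕ.NonZero n}} → (+ a) / n + (+ b) / n ≡ (+ (a ℕ.+ b)) / n
  /-distribʳ-+ a b n@(suc n-1) = toℚᵘ-injective (begin
    toℚᵘ ((+ a) / n + (+ b) / n)            ≈⟨ toℚᵘ-homo-+ ((+ a) / n) ((+ b) / n) ⟩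
    toℚᵘ ((+ a) / n) ℚᵘ.+ toℚᵘ ((+ b) / n)  ≈⟨ ℚᵘ.+-cong (toℚᵘ-/ (+ a) n) (toℚᵘ-/ (+ b) n) ⟩
    mkℚᵘ (+ a) n-1 ℚᵘ.+ mkℚᵘ (+ b) n-1      ≈⟨ *≡* (trans (cong (ℤ._* + n) (sym (ℤ.*-distribʳ-+ (+ n) (+ a) (+ b))))
                                                (ℤ.*-assoc (+ a ℤ.+ + b) (+ n) (+ n))) ⟩
    mkℚᵘ (+ (a ℕ.+ b)) n-1                  ≈⟨ toℚᵘ-/ (+ (a ℕ.+ b)) n ⟨
    toℚᵘ ((+ (a ℕ.+ b)) / n)                ∎)
    where open import Relation.Binary.Reasoning.Setoid ℚᵘ.≃-setoid

  m/1*a/n≡ma/n : ∀ m a n .{{_ : ℕ.NonZero n}} → (+ m) / 1 * ((+ a) / n) ≡ (+ (m ℕ.* a)) / n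
  m/1*a/n≡ma/n m a n@(suc n-1) = toℚᵘ-injective (begin
    toℚᵘ ((+ m) / 1 * ((+ a) / n))          ≈⟨ toℚᵘ-homo-* ((+ m) / 1) ((+ a) / n) ⟩
    toℚᵘ ((+ m) / 1) ℚᵘ.* toℚᵘ ((+ a) / n)  ≈⟨ ℚᵘ.*-cong (toℚᵘ-/ (+ m) 1) (toℚᵘ-/ (+ a) n) ⟩
    mkℚᵘ (+ m) 0 ℚᵘ.* mkℚᵘ (+ a) n-1        ≈⟨ *≡* (cong₂ ℤ._*_ (sym (ℤ.pos-* m a)) (cong +_ (sym (ℕ.+-identityʳ n)))) ⟩
    mkℚᵘ (+ (m ℕ.* a)) n-1                  ≈⟨ toℚᵘ-/ (+ (m ℕ.* a)) n ⟨
    toℚᵘ ((+ (m ℕ.* a)) / n)                ∎)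
    where open import Relation.Binary.Reasoning.Setoid ℚᵘ.≃-setoid

  ÷-*-cancel : ∀ p q .{{_ : ℚ.NonZero q}} → p ÷ q * q ≡ p
  ÷-*-cancel p q = trans (*-assoc p (1/ q) q) (trans (cong (p *_) (*-inverseˡ q)) (*-identityʳ p))

  ≤*⇒÷≤ : ∀ {p q r} .{{_ : Positive q}} .{{_ : ℚ.NonZero q}} → p ≤ r * q → p ÷ q ≤ r
  ≤*⇒÷≤ {p} {q} p≤rq = *-cancelʳ-≤-pos q (≤-trans (≤-reflexive (÷-*-cancel p q)) p≤rq)

  *≤⇒≤÷ : ∀ {p q r} .{{_ : Positive q}} .{{_ : ℚ.NonZero q}} → r * q ≤ p → r ≤ p ÷ q
  *≤⇒≤÷ {p} {q} rq≤p = *-cancelʳ-≤-pos q (≤-trans rq≤p (≤-reflexive (sym (÷-*-cancel p q))))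

  n<2^n : ∀ n → n ℕ.< 2 ℕ.^ n
  n<2^n zero    = ℕ.s≤s ℕ.z≤n
  n<2^n (suc n) = ℕ.+-mono-≤ (ℕ.m^n>0 2 n) (ℕ.≤-trans (n<2^n n) (ℕ.m≤m+n _ 0))

  -- The denominator q of ε serves as e: a positive ε is at least 1 / q, and q < 2 ^ q.
  archimedean : ∀ ε → 0ℚ < ε → ∃ λ e → 1 ℕ.≤ e × 1ℚ ≤ (+ (2 ℕ.^ e)) / 1 * ε
  archimedean ε@(mkℚ +[1+ p ] q-1 _) _ = suc q-1 , ℕ.s≤s ℕ.z≤n , toℚᵘ-cancel-≤ (begin
    ℚᵘ.1ℚᵘ                                  ≤⟨ *≤* (subst₂ ℤ._≤_ (sym (ℤ.*-identityˡ (+ suc q-1))) (sym (ℤ.*-identityʳ (+ (m ℕ.* suc p)))) (ℤ.+≤+ bound)) ⟩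
    mkℚᵘ (+ (m ℕ.* suc p)) q-1              ≃⟨ *≡* (cong₂ ℤ._*_ (ℤ.pos-* m (suc p)) (cong +_ (ℕ.+-identityʳ (suc q-1)))) ⟩
    mkℚᵘ (+ m) 0 ℚᵘ.* toℚᵘ ε                ≃⟨ ℚᵘ.*-congʳ {toℚᵘ ε} (toℚᵘ-/ (+ m) 1) ⟨
    toℚᵘ ((+ m) / 1) ℚᵘ.* toℚᵘ ε            ≃⟨ toℚᵘ-homo-* ((+ m) / 1) ε ⟨
    toℚᵘ ((+ m) / 1 * ε)                    ∎)
    where
    open ℚᵘ.≤-Reasoning
    m = 2 ℕ.^ suc q-1
    bound : suc q-1 ℕ.≤ m ℕ.* suc p
    bound = ℕ.≤-trans (ℕ.<⇒≤ (n<2^n (suc q-1))) (ℕ.m≤m*n m (suc p))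
  archimedean (mkℚ (+ 0) _ _) (*<* (ℤ.+<+ ()))
  archimedean (mkℚ ℤ.-[1+ _ ] _ _) (*<* ())

  -- The bad part b is at most y / c, and 1 / c ≤ ε, so at least (1 - ε) * y is left for g.
  conditional-≥ : ∀ {ε c g b y} .{{_ : Positive c}} .{{_ : Positive y}} .{{_ : ℚ.NonZero y}} →
                  1ℚ ≤ c * ε → g + b ≡ y → c * b ≤ y → 1ℚ - ε ≤ g ÷ y
  conditional-≥ {ε} {c} {g} {b} {y} 1≤cε g+b≡y cb≤y = *≤⇒≤÷ (begin
    (1ℚ - ε) * y          ≡⟨ expand ε y ⟩
    y - ε * y             ≡⟨ cong (λ z → z - ε * y) g+b≡y ⟨
    g + b - ε * y         ≡⟨ +-assoc g b (- (ε * y)) ⟩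
    g + (b - ε * y)       ≤⟨ +-monoʳ-≤ g (+-monoˡ-≤ (- (ε * y)) b≤εy) ⟩
    g + (ε * y - ε * y)   ≡⟨ trans (cong (λ z → g + z) (+-inverseʳ (ε * y))) (+-identityʳ g) ⟩
    g                     ∎)
    where
    open ≤-Reasoning
    open +-*-Solver
    expand : ∀ ε y → (1ℚ - ε) * y ≡ y - ε * y
    expand = solve 2 (λ ε y → (con 1ℚ :- ε) :* y := y :- ε :* y) refl
    b≤εy : b ≤ ε * y
    b≤εy = *-cancelˡ-≤-pos c (begin
      c * b          ≤⟨ cb≤y ⟩
      y              ≡⟨ *-identityˡ y ⟨
      1ℚ * y         ≤⟨ *-monoʳ-≤-nonNeg y {{pos⇒nonNeg y}} 1≤cε ⟩
      c * ε * y      ≡⟨ *-assoc c ε y ⟩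
      c * (ε * y)    ∎)

  module _ {k n} (k≤n : k ℕ.≤ n) where

    private
      K = kSubsets n k
      instance
        K≢0 : NonZero (length K)
        K≢0 = kSubsets-nonEmpty k≤n

    Pr-÷-≤ : ∀ {p q} {P : Pred (Subset n) p} {Q : Pred (Subset n) q} (P? : Decidable P) (Q? : Decidable Q)
             m .{{_ : NonZero m}} .{{_ : ℚ.NonZero ((+ m) / 1)}} →
             count P? K ℕ.≤ m ℕ.* count Q? K → Pr k≤n P? ÷ ((+ m) / 1) ≤ Pr k≤n Q?
    Pr-÷-≤ P? Q? m a≤mb = ≤*⇒÷≤ {{normalize-pos m 1}} (begin
      (+ count P? K) / length K                  ≤⟨ /-monoˡ-≤ (length K) a≤mb ⟩
      (+ (m ℕ.* count Q? K)) / length K          ≡⟨ m/1*a/n≡ma/n m (count Q? K) (length K) ⟨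
      (+ m) / 1 * Pr k≤n Q?                      ≡⟨ *-comm ((+ m) / 1) (Pr k≤n Q?) ⟩
      Pr k≤n Q? * ((+ m) / 1)                    ∎)
      where open ≤-Reasoning

    CondPr-∁-≥ : ∀ {p q} {P : Pred (Subset n) p} {Q : Pred (Subset n) q} (P? : Decidable P) (Q? : Decidable Q)
                 {ε} m .{{_ : NonZero m}} .{{_ : NonZero (count Q? K)}} .{{_ : ℚ.NonZero (Pr k≤n Q?)}} →
                 1ℚ ≤ (+ m) / 1 * ε → m ℕ.* count (Q? ∩? P?) K ℕ.≤ count Q? K →
                 1ℚ - ε ≤ CondPr k≤n (∁? P?) Q?
    CondPr-∁-≥ P? Q? m 1≤mε bound = conditional-≥ {c = (+ m) / 1} {(+ good) / L} {(+ bad) / L} {(+ total) / L}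
      {{normalize-pos m 1}} {{normalize-pos total L}} 1≤mε
      (trans (/-distribʳ-+ good bad L) (cong (λ x → (+ x) / L) good+bad))
      (≤-trans (≤-reflexive (m/1*a/n≡ma/n m bad L)) (/-monoˡ-≤ L bound))
      where
      L = length K
      good = count (∁? P? ∩? Q?) K
      bad = count (Q? ∩? P?) K
      total = count Q? K
      good+bad : good ℕ.+ bad ≡ total
      good+bad = trans (ℕ.+-comm good bad) (trans
        -- `CondPr` intersects with the condition on the right, `count-split` with it on the left.
        (cong (bad ℕ.+_) (count-≐ (∁? P? ∩? Q?) (Q? ∩? ∁? P?) (swap , swap) K))
        (sym (count-split Q? P? K)))

    isolated⇒Pr : ∀ {d e T} {H : Hypergraph n d} (d≤k : d ℕ.≤ k) {ε}
                  .{{_ : NonZero T}} .{{_ : ℚ.NonZero ((+ T) / 1)}} →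
                  1ℚ ≤ (+ (2 ℕ.^ e)) / 1 * ε → Isolated e k H T →
                  Σ[ H′ ∈ Hypergraph n d ]
                    (H′ ⊆ᴴ H) ×
                    (Pr k≤n (hits? H) ÷ ((+ T) / 1) ≤ Pr k≤n (hits? H′)) ×
                    ((I : Subset n) (I∈H′ : Edge H′ I) →
                      1ℚ - ε ≤ CondPr k≤n (∁? (hits? (H′ ∖ I))) (I ⊆?_) {{edge-Pr-nonZero H′ I∈H′ d≤k k≤n}})
    isolated⇒Pr {e = e} {T} {H} d≤k 1≤2^eε iso = sub , sub⊆ , Pr-÷-≤ (hits? H) (hits? sub) T hits-≤ , λ I I∈H′ →
      CondPr-∁-≥ (hits? (sub ∖ I)) (I ⊆?_) (2 ℕ.^ e)
        {{ℕ.m^n≢0 2 e}}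
        {{count-⊇-nonZero I (ℕ.≤-trans (ℕ.≤-reflexive (uniform sub I∈H′)) d≤k) k≤n}}
        {{edge-Pr-nonZero sub I∈H′ d≤k k≤n}}
        1≤2^eε (isolated I∈H′)
      where open Isolated iso

open Counting
open Fractions
open import Data.Integer using (+_)
open import Data.Nat.Properties using (m^n≢0)
open import Data.Rational using (ℚ; 0ℚ; 1ℚ; _<_; _≤_; _-_; _÷_; _/_; >-nonZero)
open import Data.Rational.Properties using (≤-refl; normalize-pos; positive⁻¹)

lemma1p6 : (ε : ℚ) → 0ℚ < ε →
    ∃[ A ] ((d : ℕ) → 1 ℕ.≤ d →
    Σ[ C ∈ ℚ ] Σ[ C>0 ∈ 0ℚ < C ]
    (C ≤ + (2 ℕ.^ (A ℕ.* d ℕ.^ 3)) / 1) ×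
    ((k n : ℕ) (d≤k : d ℕ.≤ k) (k≤n : k ℕ.≤ n) (H : Hypergraph n d) →
    Σ[ H′ ∈ Hypergraph n d ]
    (H′ ⊆ᴴ H) ×
    (_÷_ (Pr k≤n (hits? H)) C {{>-nonZero C>0}} ≤ Pr k≤n (hits? H′)) ×
    ((I : Subset n) (I∈H′ : Edge H′ I) →
    1ℚ - ε ≤ CondPr k≤n (∁? (hits? (H′ ∖ I))) (I ⊆?_) {{edge-Pr-nonZero H′ I∈H′ d≤k k≤n}})))
lemma1p6 ε 0<ε =
  let e , 1≤e , 1≤2^eε = archimedean ε 0<ε in
  -- The witness for A is fixed before d and depends on ε only through e. C is taken equal to its
  -- upper bound.
  e ℕ.+ 5 , λ d 1≤d →
    let T   = 2 ℕ.^ ((e ℕ.+ 5) ℕ.* d ℕ.^ 3)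
        T≢0 = m^n≢0 2 ((e ℕ.+ 5) ℕ.* d ℕ.^ 3)
        C>0 = positive⁻¹ ((+ T) / 1) {{normalize-pos T 1 {{_}} {{T≢0}}}}
    in  (+ T) / 1 , C>0 , ≤-refl , λ k n d≤k k≤n H →
        isolated⇒Pr k≤n d≤k {{T≢0}} {{>-nonZero C>0}} 1≤2^eε (isolate 1≤e 1≤d d≤k k≤n H)
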